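{- Every claw-free graph $G$ satisfies $\chi_{\mathrm{pcf}}(G)\le \Delta(G)+6$.
   Context: Graphs are finite and simple. A graph is claw-free if it has no induced subgraph isomorphic to $K_{1,3}$. $\Delta(G)$ is the maximum degree. A proper conflict-free coloring of $G$ is a proper vertex coloring in which, for every non-isolated vertex $v$, some color appears exactly once in the open neighborhood $N(v)$. $\chi_{\mathrm{pcf}}(G)$ is the least $k$ such that $G$ has a proper conflict-free coloring with $k$ colors. -}

module Defs where

open import Data.Bool.Base using (Bool; true; false)
import Data.Bool.Properties as Bool
open import Data.Fin.Base using (Fin; splitAt; funToFin; finToFun)
open import Data.Fin.Properties using (_≟_; any?; all?; finToFun-funToFin)
open import Data.Fin.Subset using (Subset; ∣_∣)
import Data.List.Base as List
open import Data.List.Extrema.Nat using (max)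
open import Data.Nat.Base using (ℕ; zero; suc; _+_; _≤_; z≤n; s≤s)
open import Data.Product.Base using (_×_; _,_; ∃; ∃-syntax; proj₁; proj₂)
open import Data.Product using (∃!)
open import Data.Sum.Base using ([_,_])
import Data.Vec.Base as Vec
open import Function.Base using (_∘_; const; id)
open import Function.Bundles using (_⇔_)
open import Function.Definitions using (Injective)
open import Level using (0ℓ)
open import Relation.Binary.Core using (Rel)
open import Relation.Binary.Definitions using (Decidable; Irreflexive; Symmetric)
open import Relation.Binary.PropositionalEquality
  using (_≡_; _≢_; _≗_; refl; sym; trans; subst)
open import Relation.Nullary.Decidable using (Dec; yes; no; does; map′; ¬?; _×-dec_; _→-dec_)
open import Relation.Nullary.Negation using (¬_; contradiction)
import Relation.Unary as U

record Graph (n : ℕ) : Set₁ where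
  field
    Adj        : Rel (Fin n) 0ℓ
    adj?       : Decidable Adj
    adj-sym    : Symmetric Adj
    adj-irrefl : Irreflexive _≡_ Adj

open Graph public

-- The two parts are the first a and the last b vertices.
completeBipartite : (a b : ℕ) → Graph (a + b)
completeBipartite a b = record
  { Adj        = λ u v → side u ≢ side v
  ; adj?       = λ u v → ¬? (side u Bool.≟ side v)
  ; adj-sym    = λ u≢v v≡u → u≢v (sym v≡u)
  ; adj-irrefl = λ { refl u≢u → u≢u refl }
  }
  where
  side : Fin (a + b) → Bool
  side u = [ const true , const false ] (splitAt a u)

-- G has an induced subgraph isomorphic to H.
ContainsInduced : ∀ {m n} → Graph m → Graph n → Set
ContainsInduced {m} {n} H G =
  ∃[ f ] Injective {A = Fin m} {B = Fin n} _≡_ _≡_ f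
       × (∀ u v → Adj H u v ⇔ Adj G (f u) (f v))

ClawFree : ∀ {n} → Graph n → Set
ClawFree G = ¬ ContainsInduced (completeBipartite 1 3) G

module _ {n} (G : Graph n) where

  N : Fin n → Subset n
  N v = Vec.tabulate (λ w → does (adj? G v w))

  degree : Fin n → ℕ
  degree v = ∣ N v ∣

  -- The graph without vertices gets maximum degree 0.
  Δ : ℕ
  Δ = max 0 (List.tabulate degree)

  IsProper : ∀ {k} → (Fin n → Fin k) → Set
  IsProper φ = ∀ u v → Adj G u v → φ u ≢ φ v

  -- ∃ (Adj G v) says that v is not isolated.
  IsConflictFree : ∀ {k} → (Fin n → Fin k) → Set
  IsConflictFree φ =
    ∀ v → ∃ (Adj G v) → ∃[ c ] ∃! _≡_ (λ w → Adj G v w × φ w ≡ c)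

  IsPCF : ∀ {k} → (Fin n → Fin k) → Set
  IsPCF φ = IsProper φ × IsConflictFree φ

  PCFColorable : ℕ → Set
  PCFColorable k = ∃ (IsPCF {k})

IsLeast : (ℕ → Set) → ℕ → Set
IsLeast P k = P k × (∀ j → P j → k ≤ j)

least : {P : ℕ → Set} → U.Decidable P → ∀ n → P n → ∃ (IsLeast P)
least P? zero    p = 0 , p , λ _ _ → z≤n
least P? (suc n) p with P? 0
... | yes p₀ = 0 , p₀ , λ _ _ → z≤n
... | no ¬p₀ with least (P? ∘ suc) n p
...   | k , pₖ , k≤ = suc k , pₖ , λ where
  zero    p₀ → contradiction p₀ ¬p₀
  (suc j) pⱼ → s≤s (k≤ j pⱼ)

module _ {n} (G : Graph n) where

  isPCF? : ∀ {k} (φ : Fin n → Fin k) → Dec (IsPCF G φ)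
  isPCF? φ =
    all? (λ u → all? λ v → adj? G u v →-dec ¬? (φ u ≟ φ v))
    ×-dec
    all? (λ v → any? (adj? G v) →-dec any? λ c → unique? (λ w → adj? G v w ×-dec φ w ≟ c))
    where
    unique? : {P : Fin n → Set} → U.Decidable P → Dec (∃! _≡_ P)
    unique? P? = any? λ w → P? w ×-dec
      map′ (λ h {y} → h y) (λ h y → h {y}) (all? λ y → P? y →-dec w ≟ y)

  IsPCF-resp-≗ : ∀ {k} {φ ψ : Fin n → Fin k} → φ ≗ ψ → IsPCF G φ → IsPCF G ψ
  IsPCF-resp-≗ φ≗ψ (proper , cf) =
      (λ u v uv ψu≡ψv → proper u v uv (trans (φ≗ψ u) (trans ψu≡ψv (sym (φ≗ψ v)))))
    , (λ v nb → let c , w , (vw , φw≡c) , unique = cf v nb in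
         c , w , (vw , trans (sym (φ≗ψ w)) φw≡c)
           , λ (vy , ψy≡c) → unique (vy , trans (φ≗ψ _) ψy≡c))

  pcfColorable? : U.Decidable (PCFColorable G)
  pcfColorable? k = map′
    (λ (i , p) → finToFun i , p)
    (λ (φ , p) → funToFin φ , IsPCF-resp-≗ (sym ∘ finToFun-funToFin φ) p)
    (any? (isPCF? ∘ finToFun {k} {n}))

  -- Giving all vertices distinct colours shows that χpcf is well defined.
  pcfColorable-n : PCFColorable G n
  pcfColorable-n = id
    , (λ u v uv u≡v → adj-irrefl G u≡v uv)
    , (λ v (w , vw) → w , w , (vw , refl) , λ (_ , y≡w) → sym y≡w)

  χpcf : ℕ
  χpcf = proj₁ (least pcfColorable? n pcfColorable-n)

  χpcf-isLeast : IsLeast (PCFColorable G) χpcf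
  χpcf-isLeast = proj₂ (least pcfColorable? n pcfColorable-n)

{-# OPTIONS --safe #-}

-- Recolouring. In a proper colouring of a claw-free graph every colour occurs at most twice in a
-- neighbourhood N(u); call x a single of u if its colour occurs once there. A vertex with neighbours is
-- bad if it has no single. Giving s a new colour c not seen in N(s) repairs all bad vertices of N(s),
-- and makes some u bad only if u has exactly two singles, s and another one, of colour c; such a c is
-- dangerous for s.
--
-- Let v be bad. Double counting gives a neighbour w of v for which at most one vertex of N(v) causes a
-- new forbidden colour. Assume all colours are forbidden for w. Then w does not have exactly two
-- singles, and some vertex of N(w) has at most two singles, one of them w. Let a candidate be a vertex
-- of N(w) with at most two singles, or with at most four, one of them w. A weighted double count over
-- N(w) gives a candidate s that is a single of at most one vertex of N(w) with at most two singles, and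
-- of few vertices of N(w) with three or four singles including w. A vertex with few singles sees few
-- colours, and N(s) \ N[w] is a clique, hence has no more vertices than N(s) has colours; so s can be
-- recoloured safely. If s is a neighbour of v, this repairs v. Otherwise it destroys nearly all the
-- dangers at w, because N(w) \ N[v] is a clique containing s, and afterwards w can be recoloured.
module Submission where

open import Algebra.Properties.CommutativeMonoid.Sum using ()
open import Algebra.Properties.Semiring.Sum using ()
open import Data.Empty using (⊥)
open import Data.Fin.Base using (Fin; zero; suc; _↑ʳ_; splitAt; join; inject≤)
open import Data.Fin.Properties
  using (_≟_; any?; all?; injective⇒≤; ↑ˡ-injective; ↑ʳ-injective; splitAt-↑ˡ; splitAt-↑ʳ;
         inject≤-injective; suc-injective)
open import Data.Fin.Subset using (∣_∣)
open import Data.List.Base as List using (List; []; _∷_)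
open import Data.List.Extrema.Nat using (xs≤max)
open import Data.List.Membership.Propositional.Properties using (∈-allFin; ∈-tabulate⁺)
import Data.List.Relation.Unary.All as ListAll
open import Data.Nat using (ℕ; zero; suc; _+_; _*_; _≤_; _<_; z≤n; s≤s)
open import Data.Nat.Properties hiding (_≟_; suc-injective)
open import Data.Nat.Solver using (module +-*-Solver)
open import Data.Product.Base as Product using (_×_; _,_; ∃; ∃-syntax; proj₁; proj₂)
open import Data.Sum.Base as Sum using (_⊎_; inj₁; inj₂; [_,_]′)
open import Data.Vec.Base using (Vec; []; _∷_; tabulate; lookup)
open import Data.Vec.Functional using (updateAt)
open import Data.Vec.Functional.Properties using (updateAt-updates; updateAt-minimal)
open import Data.Vec.Membership.Propositional using (_∈_)
open import Data.Vec.Relation.Unary.All using (All; []; _∷_)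
open import Data.Vec.Relation.Unary.All.Properties using (lookup⁺)
open import Data.Vec.Relation.Unary.AllPairs using ([]; _∷_)
open import Data.Vec.Relation.Unary.Any as Any using (here; there)
open import Data.Vec.Relation.Unary.Any.Properties using (lookup-index)
open import Data.Vec.Relation.Unary.Unique.Propositional using (Unique)
open import Data.Vec.Relation.Unary.Unique.Propositional.Properties using (lookup-injective)
open import Function.Base using (_∘_; id; const; case_of_)
open import Function.Bundles using (mk⇔)
open import Level using (0ℓ)
open import Relation.Binary.PropositionalEquality
open import Relation.Nullary.Decidable
  using (Dec; yes; no; does; ¬?; _×-dec_; _⊎-dec_; _→-dec_; decidable-stable)
open import Relation.Nullary.Negation using (¬_; contradiction)
open import Relation.Unary using (Pred; Decidable; _∪_; _⊆_)
open import Defs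

open Algebra.Properties.CommutativeMonoid.Sum +-0-commutativeMonoid using (sum; ∑-comm; ∑-distrib-+)
open Algebra.Properties.Semiring.Sum +-*-semiring using (*-distribˡ-sum)
open +-*-Solver using (solve; _:+_; con; _:=_)

-- Finite sums and counting by indicator functions.

sum-mono-≤ : ∀ {n} {f g : Fin n → ℕ} → (∀ i → f i ≤ g i) → sum f ≤ sum g
sum-mono-≤ {zero}  f≤g = z≤n
sum-mono-≤ {suc n} f≤g = +-mono-≤ (f≤g zero) (sum-mono-≤ (f≤g ∘ suc))

sum-mono-< : ∀ {n} {f g : Fin n → ℕ} → (∀ i → f i ≤ g i) → ∀ i → f i < g i → sum f < sum g
sum-mono-< f≤g zero    fi<gi = +-mono-<-≤ fi<gi (sum-mono-≤ (f≤g ∘ suc))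
sum-mono-< f≤g (suc i) fi<gi = +-mono-≤-< (f≤g zero) (sum-mono-< (f≤g ∘ suc) i fi<gi)

sum-<⇒∃< : ∀ {n} (f g : Fin n → ℕ) → sum f < sum g → ∃[ i ] f i < g i
sum-<⇒∃< {suc n} f g Σf<Σg with f zero <? g zero
... | yes f₀<g₀ = zero , f₀<g₀
... | no  f₀≮g₀ = Product.map suc id (sum-<⇒∃< (f ∘ suc) (g ∘ suc)
  (+-cancelˡ-< (f zero) _ _ (<-≤-trans Σf<Σg (+-monoˡ-≤ _ (≮⇒≥ f₀≮g₀)))))

ind : ∀ {A : Set} → Dec A → ℕ
ind (yes _) = 1
ind (no  _) = 0

ind-yes : ∀ {A : Set} → A → (A? : Dec A) → ind A? ≡ 1
ind-yes a (yes _) = refl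
ind-yes a (no ¬a) = contradiction a ¬a

ind-no : ∀ {A : Set} → ¬ A → (A? : Dec A) → ind A? ≡ 0
ind-no ¬a (yes a) = contradiction a ¬a
ind-no ¬a (no _)  = refl

ind-mono : ∀ {A B : Set} → (A → B) → (A? : Dec A) (B? : Dec B) → ind A? ≤ ind B?
ind-mono f (yes a) B? = ≤-reflexive (sym (ind-yes (f a) B?))
ind-mono f (no _)  B? = z≤n

# : ∀ {n} {P : Pred (Fin n) 0ℓ} → Decidable P → ℕ
# P? = sum (ind ∘ P?)

#-mono : ∀ {n} {P Q : Pred (Fin n) 0ℓ} (P? : Decidable P) (Q? : Decidable Q) → P ⊆ Q → # P? ≤ # Q?
#-mono P? Q? P⊆Q = sum-mono-≤ (λ i → ind-mono P⊆Q (P? i) (Q? i))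

#-strict : ∀ {n} {P Q : Pred (Fin n) 0ℓ} (P? : Decidable P) (Q? : Decidable Q) →
           P ⊆ Q → ∀ i → Q i → ¬ P i → # P? < # Q?
#-strict P? Q? P⊆Q i q ¬p = sum-mono-< (λ j → ind-mono P⊆Q (P? j) (Q? j)) i
  (subst₂ _<_ (sym (ind-no ¬p (P? i))) (sym (ind-yes q (Q? i))) (s≤s z≤n))

#-∅ : ∀ {n} {P : Pred (Fin n) 0ℓ} (P? : Decidable P) → (∀ i → ¬ P i) → # P? ≡ 0
#-∅ {zero}  P? ¬P = refl
#-∅ {suc n} P? ¬P = cong₂ _+_ (ind-no (¬P zero) (P? zero)) (#-∅ (P? ∘ suc) (¬P ∘ suc))

#-swap : ∀ {m n} {R : Fin m → Fin n → Set} (R? : ∀ i j → Dec (R i j)) →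
         sum (λ i → # (R? i)) ≡ sum (λ j → # (λ i → R? i j))
#-swap R? = ∑-comm (λ i j → ind (R? i j))

∣tabulate∣≡# : ∀ {n} {P : Pred (Fin n) 0ℓ} (P? : Decidable P) → ∣ tabulate (does ∘ P?) ∣ ≡ # P?
∣tabulate∣≡# {zero}  P? = refl
∣tabulate∣≡# {suc n} P? with P? zero
... | yes _ = cong suc (∣tabulate∣≡# (P? ∘ suc))
... | no  _ = ∣tabulate∣≡# (P? ∘ suc)

-- Cardinality bounds by injections, and their comparison with counts.

record AtMost {A : Set} (m : ℕ) (P : Pred A 0ℓ) : Set where
  constructor atMost
  field
    -- The index is read off a proof, so one element may receive several indices; only different
    -- elements must not share one.
    index     : ∀ {x} → P x → Fin m
    injective : ∀ {x y} (p : P x) (q : P y) → index p ≡ index q → x ≡ y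

module _ {A : Set} {P : Pred A 0ℓ} where

  atMost-≤ : ∀ {m n} → m ≤ n → AtMost m P → AtMost n P
  atMost-≤ m≤n (atMost f inj) =
    atMost (λ p → inject≤ (f p) m≤n) (λ p q → inj p q ∘ inject≤-injective m≤n m≤n _ _)

  atMost-∅ : (∀ x → ¬ P x) → AtMost 0 P
  atMost-∅ ¬P = atMost (λ p → contradiction p (¬P _)) (λ p _ _ → contradiction p (¬P _))

  atMost-1 : (∀ {x y} → P x → P y → x ≡ y) → AtMost 1 P
  atMost-1 unique = atMost (λ _ → zero) (λ p q _ → unique p q)

  module _ {B : Set} {Q : Pred B 0ℓ} where

    -- `R` may relate x to many y. Each x is indexed by the y that `total` picks for it, and
    -- `functional`, which makes the converse of `R` single-valued on P, keeps different x apart.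
    atMost-image : ∀ {m} (R : A → B → Set) → (∀ {x} → P x → ∃[ y ] Q y × R x y) →
                   (∀ {x x′ y} → P x → P x′ → R x y → R x′ y → x ≡ x′) → AtMost m Q → AtMost m P
    atMost-image R total functional (atMost f inj) = atMost
      (λ p → f (proj₁ (proj₂ (total p))))
      (λ p p′ eq → let y , q , r = total p ; y′ , q′ , r′ = total p′ in
        functional p p′ r (subst (R _) (sym (inj q q′ eq)) r′))

  atMost-⊆ : ∀ {m} {Q : Pred A 0ℓ} → P ⊆ Q → AtMost m Q → AtMost m P
  atMost-⊆ P⊆Q (atMost f inj) = atMost (f ∘ P⊆Q) (λ p q → inj (P⊆Q p) (P⊆Q q))

  atMost-∪ : ∀ {m n} {Q : Pred A 0ℓ} → AtMost m P → AtMost n Q → AtMost (m + n) (P ∪ Q)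
  atMost-∪ {m} {n} {Q} (atMost f f-inj) (atMost g g-inj) = atMost h h-inj
    where
    h : ∀ {x} → (P ∪ Q) x → Fin (m + n)
    h = join m n ∘ Sum.map f g
    h-inj : ∀ {x y} (p : (P ∪ Q) x) (q : (P ∪ Q) y) → h p ≡ h q → x ≡ y
    h-inj (inj₁ p) (inj₁ q) eq = f-inj p q (↑ˡ-injective n _ _ eq)
    h-inj (inj₂ p) (inj₂ q) eq = g-inj p q (↑ʳ-injective m _ _ eq)
    h-inj (inj₁ p) (inj₂ q) eq = case
      trans (sym (splitAt-↑ˡ m (f p) n)) (trans (cong (splitAt m) eq) (splitAt-↑ʳ m n (g q))) of λ ()
    h-inj (inj₂ p) (inj₁ q) eq = case
      trans (sym (splitAt-↑ˡ m (f q) n)) (trans (cong (splitAt m) (sym eq)) (splitAt-↑ʳ m n (g p))) of λ ()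

atMost-≡ : ∀ {A : Set} (y : A) → AtMost 1 (_≡ y)
atMost-≡ y = atMost-1 λ e e′ → trans e (sym e′)

atMost-∈ : ∀ {A : Set} {m} (xs : Vec A m) → AtMost m (_∈ xs)
atMost-∈ xs = atMost Any.index λ p q eq → trans (lookup-index p) (trans (cong (lookup xs) eq) (sym (lookup-index q)))

pigeonhole : ∀ {k m} {P : Pred (Fin k) 0ℓ} → AtMost m P → (∀ i → P i) → k ≤ m
pigeonhole (atMost f inj) all = injective⇒≤ {f = λ i → f (all i)} (inj _ _)

rank : ∀ {n} {P : Pred (Fin n) 0ℓ} (P? : Decidable P) → ∀ {x} → P x → Fin (# P?)
rank P? {zero} p with P? zero
... | yes _ = zero
... | no ¬p = contradiction p ¬p
rank P? {suc x} p with P? zero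
... | yes _ = suc (rank (P? ∘ suc) p)
... | no  _ = rank (P? ∘ suc) p

rank-injective : ∀ {n} {P : Pred (Fin n) 0ℓ} (P? : Decidable P) → ∀ {x y} (p : P x) (q : P y) →
                 rank P? p ≡ rank P? q → x ≡ y
rank-injective P? {zero}  {zero}  p q eq = refl
rank-injective P? {zero}  {suc y} p q eq with P? zero
... | yes _ = case eq of λ ()
... | no ¬p = contradiction p ¬p
rank-injective P? {suc x} {zero}  p q eq with P? zero
... | yes _ = case eq of λ ()
... | no ¬q = contradiction q ¬q
rank-injective P? {suc x} {suc y} p q eq with P? zero
... | yes _ = cong suc (rank-injective (P? ∘ suc) p q (suc-injective eq))
... | no  _ = cong suc (rank-injective (P? ∘ suc) p q eq)

atMost-# : ∀ {n} {P : Pred (Fin n) 0ℓ} (P? : Decidable P) → AtMost (# P?) P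
atMost-# P? = atMost (rank P?) (rank-injective P?)

element : ∀ {n} {P : Pred (Fin n) 0ℓ} (P? : Decidable P) → Fin (# P?) → ∃ P
element {suc n} P? i with P? zero
... | no  _ = Product.map suc id (element (P? ∘ suc) i)
... | yes p with i
...   | zero  = zero , p
...   | suc j = Product.map suc id (element (P? ∘ suc) j)

element-injective : ∀ {n} {P : Pred (Fin n) 0ℓ} (P? : Decidable P) → ∀ i j →
                    proj₁ (element P? i) ≡ proj₁ (element P? j) → i ≡ j
element-injective {suc n} P? i j eq with P? zero
... | no  _ = element-injective (P? ∘ suc) i j (suc-injective eq)
... | yes p with i | j
...   | zero  | zero  = refl
...   | zero  | suc _ = case eq of λ ()
...   | suc _ | zero  = case eq of λ ()
...   | suc i | suc j = cong suc (element-injective (P? ∘ suc) i j (suc-injective eq))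

#-atMost : ∀ {n m} {P : Pred (Fin n) 0ℓ} (P? : Decidable P) → AtMost m P → # P? ≤ m
#-atMost P? (atMost f inj) = injective⇒≤ {f = λ i → f (proj₂ (element P? i))}
  (λ {i} {j} eq → element-injective P? i j (inj _ _ eq))

atMost-unique : ∀ {A : Set} {P : Pred A 0ℓ} {m j} {xs : Vec A j} →
                AtMost m P → Unique xs → All P xs → j ≤ m
atMost-unique (atMost f inj) unique ps = injective⇒≤ {f = λ i → f (lookup⁺ ps i)}
  (λ eq → lookup-injective unique _ _ (inj _ _ eq))

#-fibres : ∀ {n k} {P : Pred (Fin n) 0ℓ} (P? : Decidable P) (φ : Fin n → Fin k) →
           sum (λ c → # (λ x → P? x ×-dec φ x ≟ c)) ≤ # P?
#-fibres P? φ = ≤-trans (≤-reflexive (#-swap (λ c x → P? x ×-dec φ x ≟ c))) (sum-mono-≤ fibre)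
  where
  fibre : ∀ x → # (λ c → P? x ×-dec φ x ≟ c) ≤ ind (P? x)
  fibre x with P? x
  ... | yes p = #-atMost (λ c → yes p ×-dec φ x ≟ c) (atMost-1 (λ (_ , e) (_ , e′) → trans (sym e) e′))
  ... | no ¬p = ≤-reflexive (#-∅ (λ c → no ¬p ×-dec φ x ≟ c) (λ _ → ¬p ∘ proj₁))

-- Claws in G.

module _ {n} (G : Graph n) (cf : ClawFree G) where

  infix 4 _~_
  _~_ : Fin n → Fin n → Set
  _~_ = Adj G

  ~-sym : ∀ {u v} → u ~ v → v ~ u
  ~-sym = adj-sym G

  ~⇒≢ : ∀ {u v} → u ~ v → u ≢ v
  ~⇒≢ u~v u≡v = adj-irrefl G u≡v u~v

  claw-free : ∀ {v a b c} → v ~ a → v ~ b → v ~ c → a ≢ b → a ≢ c → b ≢ c → a ~ b ⊎ a ~ c ⊎ b ~ c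
  claw-free {v} {a} {b} {c} va vb vc a≢b a≢c b≢c with adj? G a b | adj? G a c | adj? G b c
  ... | yes ab | _      | _      = inj₁ ab
  ... | no  _  | yes ac | _      = inj₂ (inj₁ ac)
  ... | no  _  | no  _  | yes bc = inj₂ (inj₂ bc)
  ... | no ¬ab | no ¬ac | no ¬bc = contradiction (f , (λ {i} {j} → f-injective {i} {j}) , f-induced) cf
    where
    f : Fin 4 → Fin n
    f zero                   = v
    f (suc zero)             = a
    f (suc (suc zero))       = b
    f (suc (suc (suc zero))) = c

    f-injective : ∀ {i j} → f i ≡ f j → i ≡ j
    f-injective {zero}                 {zero}                 _ = refl
    f-injective {zero}                 {suc zero}             e = contradiction e (~⇒≢ va)
    f-injective {zero}                 {suc (suc zero)}       e = contradiction e (~⇒≢ vb)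
    f-injective {zero}                 {suc (suc (suc zero))} e = contradiction e (~⇒≢ vc)
    f-injective {suc zero}             {zero}                 e = contradiction (sym e) (~⇒≢ va)
    f-injective {suc zero}             {suc zero}             _ = refl
    f-injective {suc zero}             {suc (suc zero)}       e = contradiction e a≢b
    f-injective {suc zero}             {suc (suc (suc zero))} e = contradiction e a≢c
    f-injective {suc (suc zero)}       {zero}                 e = contradiction (sym e) (~⇒≢ vb)
    f-injective {suc (suc zero)}       {suc zero}             e = contradiction (sym e) a≢b
    f-injective {suc (suc zero)}       {suc (suc zero)}       _ = refl
    f-injective {suc (suc zero)}       {suc (suc (suc zero))} e = contradiction e b≢c
    f-injective {suc (suc (suc zero))} {zero}                 e = contradiction (sym e) (~⇒≢ vc)
    f-injective {suc (suc (suc zero))} {suc zero}             e = contradiction (sym e) a≢c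
    f-injective {suc (suc (suc zero))} {suc (suc zero)}       e = contradiction (sym e) b≢c
    f-injective {suc (suc (suc zero))} {suc (suc (suc zero))} _ = refl

    leaf : Fin 3 → Fin n
    leaf i = f (suc i)

    leaves : ∀ i j → ¬ leaf i ~ leaf j
    leaves zero             zero             e = ~⇒≢ e refl
    leaves zero             (suc zero)       e = ¬ab e
    leaves zero             (suc (suc zero)) e = ¬ac e
    leaves (suc zero)       zero             e = ¬ab (~-sym e)
    leaves (suc zero)       (suc zero)       e = ~⇒≢ e refl
    leaves (suc zero)       (suc (suc zero)) e = ¬bc e
    leaves (suc (suc zero)) zero             e = ¬ac (~-sym e)
    leaves (suc (suc zero)) (suc zero)       e = ¬bc (~-sym e)
    leaves (suc (suc zero)) (suc (suc zero)) e = ~⇒≢ e refl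

    centre : ∀ i → v ~ leaf i
    centre zero             = va
    centre (suc zero)       = vb
    centre (suc (suc zero)) = vc

    -- The sides compute: `zero` is alone on its side and every `suc` is on the other. So `refl`
    -- refutes adjacency within a side, and across the sides the two Booleans are visibly distinct.
    f-induced : ∀ i j → _
    f-induced zero    zero    = mk⇔ (λ t≢t → contradiction refl t≢t) (λ e → contradiction refl (~⇒≢ e))
    f-induced zero    (suc j) = mk⇔ (λ _ → centre j) (λ _ ())
    f-induced (suc i) zero    = mk⇔ (λ _ → ~-sym (centre i)) (λ _ ())
    f-induced (suc i) (suc j) = mk⇔ (λ t≢t → contradiction refl t≢t) (λ e → contradiction e (leaves i j))

  deg : Fin n → ℕ
  deg u = # (adj? G u)

  -- Singles, seen colours and dangerous colours.

  module _ {k} (φ : Fin n → Fin k) where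

    Single : Fin n → Fin n → Set
    Single u x = u ~ x × (∀ y → u ~ y → φ y ≡ φ x → y ≡ x)

    single? : ∀ u → Decidable (Single u)
    single? u x = adj? G u x ×-dec all? λ y → adj? G u y →-dec φ y ≟ φ x →-dec y ≟ x

    σ : Fin n → ℕ
    σ u = # (single? u)

    Satisfied : Fin n → Set
    Satisfied u = ∃ (Single u)

    satisfied? : Decidable Satisfied
    satisfied? u = any? (single? u)

    Seen : Fin n → Fin k → Set
    Seen s c = ∃[ x ] s ~ x × φ x ≡ c

    seen? : ∀ s → Decidable (Seen s)
    seen? s c = any? λ x → adj? G s x ×-dec φ x ≟ c

    Tight : Fin n → Fin n → Fin n → Set
    Tight u s x = Single u s × Single u x × s ≢ x × (∀ y → Single u y → y ≡ s ⊎ y ≡ x)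

    tight? : ∀ u s → Decidable (Tight u s)
    tight? u s x = single? u s ×-dec single? u x ×-dec ¬? (s ≟ x) ×-dec
      all? λ y → single? u y →-dec (y ≟ s ⊎-dec y ≟ x)

    Dangerous : Fin n → Fin k → Set
    Dangerous s c = ∃[ u ] ∃[ x ] Tight u s x × φ x ≡ c

    -- With c equal to `φ s` the recolouring would change nothing and repair no neighbour, hence the
    -- first condition.
    Safe : Fin n → Fin k → Set
    Safe s c = c ≢ φ s × ¬ Seen s c × ¬ Dangerous s c

    dangerous? : ∀ s → Decidable (Dangerous s)
    dangerous? s c = any? λ u → any? λ x → tight? u s x ×-dec φ x ≟ c

    safe? : ∀ s → Decidable (Safe s)
    safe? s c = ¬? (c ≟ φ s) ×-dec ¬? (seen? s c) ×-dec ¬? (dangerous? s c)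

    tight-unique : ∀ {u s x y} → Tight u s x → Tight u s y → x ≡ y
    tight-unique (_ , _ , _ , only) (_ , sy , s≢y , _) with only _ sy
    ... | inj₁ y≡s = contradiction (sym y≡s) s≢y
    ... | inj₂ y≡x = sym y≡x

    tight-σ : ∀ {u s x} → Tight u s x → σ u ≤ 2
    tight-σ {u} {s} {x} (_ , _ , _ , only) = #-atMost (single? u)
      (atMost-⊆ (λ {y} sy → [ here , there ∘ here ]′ (only y sy)) (atMost-∈ (s ∷ x ∷ [])))

    seen-≤-deg : ∀ s → # (seen? s) ≤ deg s
    seen-≤-deg s = #-atMost (seen? s) (atMost-image (λ c x → φ x ≡ c) id
      (λ _ _ e e′ → trans (sym e) e′) (atMost-# (adj? G s)))

    -- A seen colour either occurs on two neighbours of s or on just one, which is then a single. In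
    -- both cases it is counted at least twice among neighbours and singles together.
    seen-double : ∀ s → # (seen? s) + # (seen? s) ≤ deg s + σ s
    seen-double s = begin
      # (seen? s) + # (seen? s)
        ≡⟨ ∑-distrib-+ (ind ∘ seen? s) (ind ∘ seen? s) ⟨
      sum (λ c → ind (seen? s c) + ind (seen? s c))
        ≤⟨ sum-mono-≤ pointwise ⟩
      sum (λ c → # (nbr? c) + # (sgl? c))
        ≡⟨ ∑-distrib-+ (λ c → # (nbr? c)) (λ c → # (sgl? c)) ⟩
      sum (λ c → # (nbr? c)) + sum (λ c → # (sgl? c))
        ≤⟨ +-mono-≤ (#-fibres (adj? G s) φ) (#-fibres (single? s) φ) ⟩
      deg s + σ s ∎
      where
      open ≤-Reasoning
      nbr? = λ c x → adj? G s x ×-dec φ x ≟ c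
      sgl? = λ c x → single? s x ×-dec φ x ≟ c
      pointwise : ∀ c → ind (seen? s c) + ind (seen? s c) ≤ # (nbr? c) + # (sgl? c)
      pointwise c with seen? s c
      ... | no _ = z≤n
      ... | yes (x , sx , φx≡c) with any? (λ y → adj? G s y ×-dec φ y ≟ c ×-dec ¬? (y ≟ x))
      ...   | yes (y , sy , φy≡c , y≢x) = ≤-trans
              (atMost-unique (atMost-# (nbr? c)) ((y≢x ∷ []) ∷ [] ∷ []) ((sy , φy≡c) ∷ (sx , φx≡c) ∷ []))
              (m≤m+n _ _)
      ...   | no ∄y = +-mono-≤
              (atMost-unique (atMost-# (nbr? c)) ([] ∷ []) ((sx , φx≡c) ∷ []))
              (atMost-unique (atMost-# (sgl? c)) ([] ∷ []) (((sx , only) , φx≡c) ∷ []))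
              where
              only : ∀ y → s ~ y → φ y ≡ φ x → y ≡ x
              only y sy φy≡φx with y ≟ x
              ... | yes y≡x = y≡x
              ... | no  y≢x = contradiction (y , sy , trans φy≡φx φx≡c , y≢x) ∄y

    -- A pigeonhole over the colours: each is seen, exceptional (in `E`, which includes the present
    -- colour), dangerous, or safe. By `tight-unique` a vertex u causes at most one danger for s, so
    -- the dangers outside the first two classes are bounded by the number of their causes,
    -- collected in `Q`.
    find-safe : ∀ {s e m} {E : Pred (Fin k) 0ℓ} {Q : Pred (Fin n) 0ℓ} →
                E (φ s) → AtMost e E → AtMost m Q →
                (∀ u x → Tight u s x → ¬ Seen s (φ x) → ¬ E (φ x) → Q u) → Decidable E →
                # (seen? s) + (e + m) < k → ∃ (Safe s)
    find-safe {s} {e} {m} {E} {Q} Eφs atE atQ inQ E? bound with any? (safe? s)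
    ... | yes safe = safe
    ... | no ∄safe = contradiction (pigeonhole all-blocked blocked) (<⇒≱ bound)
      where
      Blocked : Pred (Fin k) 0ℓ
      Blocked c = Dangerous s c × ¬ Seen s c × ¬ E c

      all-blocked : AtMost (# (seen? s) + (e + m)) (Seen s ∪ (E ∪ Blocked))
      all-blocked = atMost-∪ (atMost-# (seen? s)) (atMost-∪ atE (atMost-image
        (λ c u → ∃[ x ] Tight u s x × φ x ≡ c)
        (λ { ((u , x , t , refl) , ¬seen , ¬E) → u , inQ u x t ¬seen ¬E , x , t , refl })
        (λ { _ _ (x , t , refl) (x′ , t′ , refl) → cong φ (tight-unique t t′) })
        atQ))

      blocked : ∀ c → (Seen s ∪ (E ∪ Blocked)) c
      blocked c with seen? s c | E? c | dangerous? s c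
      ... | yes seen | _    | _     = inj₁ seen
      ... | no _     | yes e | _    = inj₂ (inj₁ e)
      ... | no ¬seen | no ¬e | yes d = inj₂ (inj₂ (d , ¬seen , ¬e))
      ... | no ¬seen | no ¬e | no ¬d =
        contradiction (c , (λ { refl → ¬e Eφs }) , ¬seen , ¬d) ∄safe

    -- Consequences of claw-freeness for a proper colouring.

    module _ (proper : IsProper G φ) where

      -- Three distinct neighbours of one colour would be pairwise nonadjacent, the leaves of a claw
      -- at u.
      twice : ∀ {u x y z} → u ~ x → u ~ y → u ~ z → φ x ≡ φ y → φ x ≡ φ z → x ≢ y → x ≢ z → y ≡ z
      twice {u} {x} {y} {z} ux uy uz φxy φxz x≢y x≢z with y ≟ z
      ... | yes y≡z = y≡z
      ... | no  y≢z with claw-free ux uy uz x≢y x≢z y≢z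
      ...   | inj₁ xy        = contradiction φxy (proper _ _ xy)
      ...   | inj₂ (inj₁ xz) = contradiction φxz (proper _ _ xz)
      ...   | inj₂ (inj₂ yz) = contradiction (trans (sym φxy) φxz) (proper _ _ yz)

      Away : Fin n → Fin n → Pred (Fin n) 0ℓ
      Away s w u = s ~ u × u ≢ w × ¬ w ~ u

      away? : ∀ s w → Decidable (Away s w)
      away? s w u = adj? G s u ×-dec ¬? (u ≟ w) ×-dec ¬? (adj? G w u)

      -- Two nonadjacent vertices of N(s) outside N[w] would form a claw at s together with w. So
      -- these vertices form a clique, and a proper colouring separates them.
      away-injective : ∀ {s w u u′} → s ~ w → Away s w u → Away s w u′ → φ u ≡ φ u′ → u ≡ u′
      away-injective {u = u} {u′} sw (su , u≢w , ¬wu) (su′ , u′≢w , ¬wu′) e with u ≟ u′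
      ... | yes u≡u′ = u≡u′
      ... | no  u≢u′ with claw-free sw su su′ (u≢w ∘ sym) (u′≢w ∘ sym) u≢u′
      ...   | inj₁ wu          = contradiction wu ¬wu
      ...   | inj₂ (inj₁ wu′)  = contradiction wu′ ¬wu′
      ...   | inj₂ (inj₂ uu′)  = contradiction e (proper _ _ uu′)

      away-≤-seen : ∀ {s w} → s ~ w → # (away? s w) ≤ # (seen? s)
      away-≤-seen {s} {w} sw = #-atMost (away? s w) (atMost-image (λ u c → φ u ≡ c)
        (λ {u} (su , _) → φ u , (u , su , refl) , refl)
        (λ p p′ e e′ → away-injective sw p p′ (trans e (sym e′)))
        (atMost-# (seen? s)))

      -- As w is a single of s, its colour is seen by s but used by no vertex away from w.
      away-<-seen : ∀ {s w} → Single s w → # (away? s w) < # (seen? s)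
      away-<-seen {s} {w} (sw , only) = <-≤-trans
        (#-strict (away? s w) or-w? inj₁ w (inj₂ refl) (λ (_ , w≢w , _) → w≢w refl))
        (#-atMost or-w? (atMost-image (λ u c → φ u ≡ c) total injective (atMost-# (seen? s))))
        where
        or-w? : Decidable (Away s w ∪ (_≡ w))
        or-w? u = away? s w u ⊎-dec u ≟ w
        total : ∀ {u} → (Away s w ∪ (_≡ w)) u → ∃[ c ] Seen s c × φ u ≡ c
        total {u} (inj₁ (su , _)) = φ u , (u , su , refl) , refl
        total {u} (inj₂ refl)     = φ w , (w , sw , refl) , refl
        injective : ∀ {u u′ c} → (Away s w ∪ (_≡ w)) u → (Away s w ∪ (_≡ w)) u′ →
                    φ u ≡ c → φ u′ ≡ c → u ≡ u′
        injective (inj₁ p) (inj₁ p′) e e′ = away-injective sw p p′ (trans e (sym e′))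
        injective (inj₁ (su , u≢w , _)) (inj₂ refl) e e′ = only _ su (trans e (sym e′))
        injective (inj₂ refl) (inj₁ (su′ , _)) e e′ = sym (only _ su′ (trans e′ (sym e)))
        injective (inj₂ refl) (inj₂ refl) _ _ = refl

      -- The left side is at most twice the number of seen colours, hence at most `deg s + σ s`. For
      -- `σ s ≤ 2` this suffices with one to spare; for `σ s ≤ 4` the strict bound of `away-<-seen`
      -- saves one, whence the 3.
      away-budget : ∀ {s w} → s ~ w → σ s ≤ 2 ⊎ (Single s w × σ s ≤ 4) →
                    # (seen? s) + # (away? s w) ≤ deg s + 3
      away-budget {s} sw (inj₁ σ≤2) = ≤-trans (+-monoʳ-≤ (# (seen? s)) (away-≤-seen sw))
        (≤-trans (seen-double s) (+-monoʳ-≤ (deg s) (≤-trans σ≤2 (n≤1+n 2))))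
      away-budget {s} _ (inj₂ (sw , σ≤4)) = budget (away-<-seen sw) (seen-double s) σ≤4
        where
        budget : ∀ {a b d e} → a < b → b + b ≤ d + e → e ≤ 4 → b + a ≤ d + 3
        budget {a} {b} {d} a<b 2b≤ e≤4 = ≤-pred (subst₂ _≤_ (+-suc b a) (+-suc d 3)
          (≤-trans (+-monoʳ-≤ b a<b) (≤-trans 2b≤ (+-monoʳ-≤ d e≤4))))

  -- The effect of recolouring one vertex.

  single-cong : ∀ {k} {φ ψ : Fin n → Fin k} {u x} → (∀ y → u ~ y → φ y ≡ ψ y) →
                Single φ u x → Single ψ u x
  single-cong φ≗ψ (ux , only) =
    ux , λ y uy e → only y uy (trans (φ≗ψ y uy) (trans e (sym (φ≗ψ _ ux))))

  tight-cong : ∀ {k} {φ ψ : Fin n → Fin k} {u s x} → (∀ y → u ~ y → φ y ≡ ψ y) →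
               Tight φ u s x → Tight ψ u s x
  tight-cong φ≗ψ (us , ux , s≢x , only) = single-cong φ≗ψ us , single-cong φ≗ψ ux , s≢x ,
    λ y uy → only y (single-cong (λ z uz → sym (φ≗ψ z uz)) uy)

  recolour : ∀ {k} → (Fin n → Fin k) → Fin n → Fin k → Fin n → Fin k
  recolour φ s c = updateAt φ s (const c)

  Unclashing : ∀ {k} → (Fin n → Fin k) → Fin n → Set
  Unclashing φ u = ∀ v → u ~ v → φ u ≢ φ v

  module _ {k} {φ : Fin n → Fin k} {s : Fin n} {c : Fin k} (¬seen : ¬ Seen φ s c) where

    recolour-fixes : Unclashing (recolour φ s c) s
    recolour-fixes v sv e = ¬seen (v , sv ,
      trans (sym (updateAt-minimal v s φ (~⇒≢ sv ∘ sym))) (trans (sym e) (updateAt-updates s φ)))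

    recolour-keeps : ∀ {u} → Unclashing φ u → Unclashing (recolour φ s c) u
    recolour-keeps {u} unclashing v uv e with u ≟ s | v ≟ s
    ... | yes refl | _        = recolour-fixes v uv e
    ... | no _     | yes refl = recolour-fixes u (~-sym uv) (sym e)
    ... | no u≢s   | no v≢s   = unclashing v uv
      (trans (sym (updateAt-minimal u s φ u≢s)) (trans e (updateAt-minimal v s φ v≢s)))

  module Recolour {k} (φ : Fin n → Fin k) (proper : IsProper G φ) (s : Fin n) (c : Fin k)
                  (c≢φs : c ≢ φ s) (¬seen : ¬ Seen φ s c) where

    φ′ : Fin n → Fin k
    φ′ = recolour φ s c

    φ′-at : φ′ s ≡ c
    φ′-at = updateAt-updates s φ

    φ′-off : ∀ {x} → x ≢ s → φ′ x ≡ φ x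
    φ′-off {x} x≢s = updateAt-minimal x s φ x≢s

    proper′ : IsProper G φ′
    proper′ u = recolour-keeps ¬seen (proper u)

    φ′-far : ∀ {u} → ¬ u ~ s → ∀ y → u ~ y → φ y ≡ φ′ y
    φ′-far ¬us y uy = sym (φ′-off λ { refl → ¬us uy })

    -- A second neighbour of u of colour c would complete a claw at u: the two share a colour, and
    -- neither is adjacent to s, which does not see c.
    c-single : ∀ {u y} → u ~ s → u ~ y → φ y ≡ c → Single φ u y
    c-single {u} {y} us uy φy≡c = uy , λ z uz φz≡φy → only z uz (trans φz≡φy φy≡c)
      where
      only : ∀ z → u ~ z → φ z ≡ c → z ≡ y
      only z uz φz≡c with z ≟ y
      ... | yes z≡y = z≡y
      ... | no  z≢y with claw-free us uy uz (λ { refl → c≢φs (sym φy≡c) })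
                                            (λ { refl → c≢φs (sym φz≡c) }) (z≢y ∘ sym)
      ...   | inj₁ sy        = contradiction (y , sy , φy≡c) ¬seen
      ...   | inj₂ (inj₁ sz) = contradiction (z , sz , φz≡c) ¬seen
      ...   | inj₂ (inj₂ yz) = contradiction (trans φy≡c (sym φz≡c)) (proper _ _ yz)

    stays-single : ∀ {u x} → Single φ u x → x ≢ s → φ x ≢ c → Single φ′ u x
    stays-single {u} {x} (ux , only) x≢s φx≢c = ux , only′
      where
      only′ : ∀ y → u ~ y → φ′ y ≡ φ′ x → y ≡ x
      only′ y uy e with y ≟ s
      ... | yes refl = contradiction (trans (sym (φ′-off x≢s)) (trans (sym e) φ′-at)) φx≢c
      ... | no  y≢s  = only y uy (trans (sym (φ′-off y≢s)) (trans e (φ′-off x≢s)))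

    was-single : ∀ {u x} → Single φ′ u x → x ≢ s → φ x ≢ φ s → Single φ u x
    was-single {u} {x} (ux , only′) x≢s φx≢φs = ux , only
      where
      only : ∀ y → u ~ y → φ y ≡ φ x → y ≡ x
      only y uy e = only′ y uy (trans (φ′-off λ { refl → φx≢φs (sym e) }) (trans e (sym (φ′-off x≢s))))

    s-single : ∀ {u} → u ~ s → (∀ y → u ~ y → φ y ≢ c) → Single φ′ u s
    s-single {u} us none = us , only′
      where
      only′ : ∀ y → u ~ y → φ′ y ≡ φ′ s → y ≡ s
      only′ y uy e with y ≟ s
      ... | yes y≡s = y≡s
      ... | no  y≢s = contradiction (trans (sym (φ′-off y≢s)) (trans e φ′-at)) (none y uy)

    -- The old colour of s occurs at most twice around u, so z keeps it alone once s has given it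
    -- up.
    twin-single : ∀ {u z} → u ~ s → u ~ z → z ≢ s → φ z ≡ φ s → Single φ′ u z
    twin-single {u} {z} us uz z≢s φz≡φs = uz , only′
      where
      only′ : ∀ y → u ~ y → φ′ y ≡ φ′ z → y ≡ z
      only′ y uy e with y ≟ s
      ... | yes refl = contradiction (trans (sym φ′-at) (trans e (trans (φ′-off z≢s) φz≡φs))) c≢φs
      ... | no  y≢s  = twice φ proper us uy uz
        (sym (trans (sym (φ′-off y≢s)) (trans e (trans (φ′-off z≢s) φz≡φs)))) (sym φz≡φs) (y≢s ∘ sym) (z≢s ∘ sym)

    untwinned : ∀ {u} → u ~ s → (∀ z → u ~ z → φ z ≡ φ s → ¬ z ≢ s) → Single φ u s
    untwinned {u} us ∄z = us , only
      where
      only : ∀ z → u ~ z → φ z ≡ φ s → z ≡ s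
      only z uz e with z ≟ s
      ... | yes z≡s = z≡s
      ... | no  z≢s = contradiction z≢s (∄z z uz e)

    -- This covers bad u too. If c is absent around u, then s becomes a single; if some z shares the
    -- old colour of s, then z does. Otherwise s and the vertex y of colour c are both singles of u,
    -- and since c is not dangerous there is a third single, which survives.
    near-satisfied : ¬ Dangerous φ s c → ∀ {u} → u ~ s → Satisfied φ′ u
    near-satisfied ¬danger {u} us with any? (λ y → adj? G u y ×-dec φ y ≟ c)
    ... | no ∄y = s , s-single us (λ y uy e → ∄y (y , uy , e))
    ... | yes (y , uy , φy≡c) with any? (λ z → adj? G u z ×-dec φ z ≟ φ s ×-dec ¬? (z ≟ s))
    ...   | yes (z , uz , φz≡φs , z≢s) = z , twin-single us uz z≢s φz≡φs
    ...   | no ∄z with any? (λ x → single? φ u x ×-dec ¬? (x ≟ s) ×-dec ¬? (x ≟ y))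
    ...     | yes (x , sx , x≢s , x≢y) = x , stays-single sx x≢s
                (λ φx≡c → x≢y (proj₂ (c-single us uy φy≡c) x (proj₁ sx) (trans φx≡c (sym φy≡c))))
    ...     | no ∄x = contradiction
                (u , y , (untwinned us (λ z uz e z≢s → ∄z (z , uz , e , z≢s)) , c-single us uy φy≡c , s≢y , only) , φy≡c)
                ¬danger
              where
              s≢y : s ≢ y
              s≢y refl = c≢φs (sym φy≡c)
              only : ∀ x → Single φ u x → x ≡ s ⊎ x ≡ y
              only x sx with x ≟ s | x ≟ y
              ... | yes x≡s | _       = inj₁ x≡s
              ... | no _    | yes x≡y = inj₂ x≡y
              ... | no x≢s  | no x≢y  = contradiction (x , sx , x≢s , x≢y) ∄x

    still-satisfied : ¬ Dangerous φ s c → ∀ {u} → Satisfied φ u → Satisfied φ′ u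
    still-satisfied ¬danger {u} (x , sx) with adj? G u s
    ... | yes us = near-satisfied ¬danger us
    ... | no ¬us = x , single-cong (φ′-far ¬us) sx

    -- In φ′ neither s nor the vertex y of colour c is a single of u, so u had two singles more in φ.
    new-danger : ∀ {u w x} → u ~ s → w ~ s → Tight φ′ u w x → ¬ Seen φ′ w (φ′ x) → φ′ x ≢ φ s →
                 Single φ u w × Single φ u s × ¬ σ φ u ≤ 2 × σ φ u ≤ 4
    new-danger {u} {w} {x} us ws (w′ , x′ , w≢x , only) ¬seen′ φ′x≢φs =
      at (any? λ y → adj? G u y ×-dec φ y ≟ c)
      where
      x≢s : x ≢ s
      x≢s refl = ¬seen′ (s , ws , refl)
      φ′x : φ′ x ≡ φ x
      φ′x = φ′-off x≢s
      φx≢c : φ x ≢ c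
      φx≢c e = ¬seen′ (s , ws , trans φ′-at (trans (sym e) (sym φ′x)))
      φx≢φs : φ x ≢ φ s
      φx≢φs = φ′x≢φs ∘ trans φ′x
      s≢w : s ≢ w
      s≢w = ~⇒≢ ws ∘ sym
      w-sg : Single φ u w
      w-sg = was-single w′ (~⇒≢ ws) (proper _ _ ws)
      x-sg : Single φ u x
      x-sg = was-single x′ x≢s φx≢φs
      s-sg : Single φ u s
      s-sg = untwinned us λ z uz φz≡φs z≢s → case only z (twin-single us uz z≢s φz≡φs) of λ
        { (inj₁ refl) → proper _ _ ws φz≡φs ; (inj₂ refl) → φx≢φs φz≡φs }
      at : Dec (∃[ y ] u ~ y × φ y ≡ c) → Single φ u w × Single φ u s × ¬ σ φ u ≤ 2 × σ φ u ≤ 4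
      -- Were c absent around u, s would be a single of u in `φ′`, but the only singles there are w
      -- and x.
      at (no ∄y) = case only s (s-single us λ y uy e → ∄y (y , uy , e)) of λ
        { (inj₁ s≡w) → contradiction s≡w s≢w ; (inj₂ s≡x) → contradiction (sym s≡x) x≢s }
      at (yes (y , uy , φy≡c)) = w-sg , s-sg ,
        (λ σ≤2 → contradiction
          (≤-trans (atMost-unique (atMost-# (single? φ u))
            ((w≢x ∷ (s≢w ∘ sym) ∷ []) ∷ (x≢s ∷ []) ∷ [] ∷ []) (w-sg ∷ x-sg ∷ s-sg ∷ [])) σ≤2)
          (<⇒≱ ≤-refl)) ,
        #-atMost (single? φ u) (atMost-⊆ (λ {z} → four z) (atMost-∈ (w ∷ x ∷ s ∷ y ∷ [])))
        where
        -- A single other than s and y does not have colour c, so it survives in `φ′` and must be w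
        -- or x.
        four : ∀ z → Single φ u z → z ∈ w ∷ x ∷ s ∷ y ∷ []
        four z sz with z ≟ s | z ≟ y
        ... | yes z≡s | _       = there (there (here z≡s))
        ... | no _    | yes z≡y = there (there (there (here z≡y)))
        ... | no z≢s  | no z≢y with only z (stays-single sz z≢s
                (λ e → z≢y (proj₂ (c-single us uy φy≡c) z (proj₁ sz) (trans e (sym φy≡c)))))
        ...   | inj₁ z≡w = here z≡w
        ...   | inj₂ z≡x = there (here z≡x)

  -- Harmful vertices around a bad vertex.

  -- Dangers of a seen colour are left out: that colour is forbidden already, and the claw argument
  -- of `harmful-unique` relies on the colour being unseen.
  Harmful : ∀ {k} → (Fin n → Fin k) → Fin n → Fin n → Set
  Harmful φ w u = ∃[ x ] Tight φ u w x × ¬ Seen φ w (φ x)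

  harmful? : ∀ {k} (φ : Fin n → Fin k) w → Decidable (Harmful φ w)
  harmful? φ w u = any? λ x → tight? φ u w x ×-dec ¬? (seen? φ w (φ x))

  HarmfulNear : ∀ {k} → (Fin n → Fin k) → Fin n → Fin n → Fin n → Set
  HarmfulNear φ v w u = v ~ w × v ~ u × Harmful φ w u

  harmfulNear? : ∀ {k} (φ : Fin n → Fin k) v w → Decidable (HarmfulNear φ v w)
  harmfulNear? φ v w u = adj? G v w ×-dec adj? G v u ×-dec harmful? φ w u

  module _ {k} (φ : Fin n → Fin k) (proper : IsProper G φ)
           (v : Fin n) (unsat : ¬ Satisfied φ v) where

    -- The colour of w₂ occurs twice around v, and by claw-freeness w₁ sees its second occurrence.
    harmful-unique : ∀ {u w₁ w₂} → HarmfulNear φ v w₁ u → HarmfulNear φ v w₂ u → w₁ ≡ w₂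
    harmful-unique {u} {w₁} {w₂} (vw₁ , _ , x , (sw₁ , _ , _ , only) , ¬seen)
                   (vw₂ , _ , _ , (sw₂ , _) , _) with w₁ ≟ w₂
    ... | yes w₁≡w₂ = w₁≡w₂
    ... | no  w₁≢w₂ with only w₂ sw₂
    ...   | inj₁ w₂≡w₁ = sym w₂≡w₁
    ...   | inj₂ refl with any? (λ z → adj? G v z ×-dec φ z ≟ φ w₂ ×-dec ¬? (z ≟ w₂))
    ...     | no ∄z = contradiction (w₂ , vw₂ , alone) unsat
              where
              alone : ∀ z → v ~ z → φ z ≡ φ w₂ → z ≡ w₂
              alone z vz e with z ≟ w₂
              ... | yes z≡w₂ = z≡w₂
              ... | no  z≢w₂ = contradiction (z , vz , e , z≢w₂) ∄z
    ...     | yes (z , vz , e , z≢w₂)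
              with claw-free vw₁ vw₂ vz w₁≢w₂
                     (λ { refl → w₁≢w₂ (proj₂ sw₂ _ (proj₁ sw₁) e) }) (z≢w₂ ∘ sym)
    ...       | inj₁ w₁w₂       = contradiction (w₂ , w₁w₂ , refl) ¬seen
    ...       | inj₂ (inj₁ w₁z) = contradiction (z , w₁z , e) ¬seen
    ...       | inj₂ (inj₂ w₂z) = contradiction (sym e) (proper _ _ w₂z)

    -- By `harmful-unique` each u in N(v) is harmful near v for at most one w, so the counts sum to
    -- at most `deg v`, which is less than twice `deg v`.
    few-harmful : ∃ (v ~_) → ∃[ w ] v ~ w × # (harmfulNear? φ v w) ≤ 1
    few-harmful (a , va) = conclude (sum-<⇒∃< (λ w → # (harmfulNear? φ v w)) twofold few)
      where
      -- The bound is 2 on N(v) and 0 elsewhere, so being strictly below it also puts w into N(v).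
      twofold : Fin n → ℕ
      twofold w = ind (adj? G v w) + ind (adj? G v w)

      per-vertex : ∀ u → # (λ w → harmfulNear? φ v w u) ≤ ind (adj? G v u)
      per-vertex u with adj? G v u
      ... | yes vu = #-atMost (λ w → adj? G v w ×-dec yes vu ×-dec harmful? φ w u) (atMost-1 harmful-unique)
      ... | no ¬vu = ≤-reflexive (#-∅ (λ w → adj? G v w ×-dec no ¬vu ×-dec harmful? φ w u) (λ _ → ¬vu ∘ proj₁ ∘ proj₂))

      few : sum (λ w → # (harmfulNear? φ v w)) < sum twofold
      few = begin-strict
        sum (λ w → # (harmfulNear? φ v w))         ≡⟨ #-swap (harmfulNear? φ v) ⟩
        sum (λ u → # (λ w → harmfulNear? φ v w u)) ≤⟨ sum-mono-≤ per-vertex ⟩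
        deg v                                      <⟨ m<m+n (deg v) (atMost-unique (atMost-# (adj? G v)) ([] ∷ []) (va ∷ [])) ⟩
        deg v + deg v                              ≡⟨ ∑-distrib-+ (ind ∘ adj? G v) (ind ∘ adj? G v) ⟨
        sum twofold                                ∎
        where open ≤-Reasoning

      within : ∀ {w m} (vw? : Dec (v ~ w)) → m < ind vw? + ind vw? → v ~ w × m ≤ 1
      within (yes vw) lt = vw , ≤-pred lt

      conclude : (∃[ w ] # (harmfulNear? φ v w) < twofold w) → ∃[ w ] v ~ w × # (harmfulNear? φ v w) ≤ 1
      conclude (w , lt) = w , within (adj? G v w) lt

  -- The weighted double count over the neighbourhood of w.

  module Averaging {k} (φ : Fin n → Fin k) (w : Fin n) where

    Narrow : Fin n → Set
    Narrow u = Single φ u w × σ φ u ≤ 2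

    narrow? : Decidable Narrow
    narrow? u = single? φ u w ×-dec σ φ u ≤? 2

    -- `Satisfied` rules out vertices without singles, in particular the bad vertex under repair,
    -- which must differ from the chosen s.
    Candidate : Fin n → Set
    Candidate s = w ~ s × Satisfied φ s × (σ φ s ≤ 2 ⊎ (Single φ s w × σ φ s ≤ 4))

    candidate? : Decidable Candidate
    candidate? s = adj? G w s ×-dec satisfied? φ s ×-dec
      (σ φ s ≤? 2 ⊎-dec (single? φ s w ×-dec σ φ s ≤? 4))

    -- These u include every neighbour of w that makes a colour dangerous for the candidate s.
    Two : Fin n → Fin n → Set
    Two s u = Candidate s × Single φ u s × w ~ u × σ φ u ≤ 2

    two? : ∀ s → Decidable (Two s)
    two? s u = candidate? s ×-dec single? φ u s ×-dec adj? G w u ×-dec σ φ u ≤? 2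

    -- These u may become tight for w once s is recoloured; the conditions are those that
    -- `new-danger` delivers.
    Four : Fin n → Fin n → Set
    Four s u = Candidate s × Single φ u s × w ~ u × Single φ u w × ¬ σ φ u ≤ 2 × σ φ u ≤ 4

    four? : ∀ s → Decidable (Four s)
    four? s u = candidate? s ×-dec single? φ u s ×-dec adj? G w u ×-dec single? φ u w ×-dec
      ¬? (σ φ u ≤? 2) ×-dec σ φ u ≤? 4

    -- The weights 3, 2 and the capacities 4, 6 are such that every u is charged at most its capacity, a
    -- narrow u strictly less, while a load below capacity is light enough for deg + 6 colours.
    load : Fin n → ℕ
    load s = 3 * # (two? s) + 2 * # (four? s)

    load′ : Fin n → ℕ
    load′ u = 3 * # (λ s → two? s u) + 2 * # (λ s → four? s u)

    weight : ∀ {s} → Dec (Candidate s) → Dec (Narrow s) → ℕ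
    weight (no _)  _       = 0
    weight (yes _) (yes _) = 4
    weight (yes _) (no _)  = 6

    capacity : Fin n → ℕ
    capacity s = weight (candidate? s) (narrow? s)

    Σ-load : sum load ≡ sum load′
    Σ-load = begin
      sum load
        ≡⟨ ∑-distrib-+ (λ s → 3 * # (two? s)) (λ s → 2 * # (four? s)) ⟩
      sum (λ s → 3 * # (two? s)) + sum (λ s → 2 * # (four? s))
        ≡⟨ cong₂ _+_ (*-distribˡ-sum 3 (λ s → # (two? s))) (*-distribˡ-sum 2 (λ s → # (four? s))) ⟨
      3 * sum (λ s → # (two? s)) + 2 * sum (λ s → # (four? s))
        ≡⟨ cong₂ (λ a b → 3 * a + 2 * b) (#-swap two?) (#-swap four?) ⟩
      3 * sum (λ u → # (λ s → two? s u)) + 2 * sum (λ u → # (λ s → four? s u))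
        ≡⟨ cong₂ _+_ (*-distribˡ-sum 3 (λ u → # (λ s → two? s u))) (*-distribˡ-sum 2 (λ u → # (λ s → four? s u))) ⟩
      sum (λ u → 3 * # (λ s → two? s u)) + sum (λ u → 2 * # (λ s → four? s u))
        ≡⟨ ∑-distrib-+ (λ u → 3 * # (λ s → two? s u)) (λ u → 2 * # (λ s → four? s u)) ⟨
      sum load′ ∎
      where open ≡-Reasoning

    two-≤ : ∀ u → # (λ s → two? s u) ≤ σ φ u
    two-≤ u = #-mono (λ s → two? s u) (single? φ u) (proj₁ ∘ proj₂)

    -- The single w of u is not counted, since w is not its own neighbour and so no candidate.
    two-< : ∀ {u} → Single φ u w → # (λ s → two? s u) < σ φ u
    two-< {u} uw = #-strict (λ s → two? s u) (single? φ u) (proj₁ ∘ proj₂) w uw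
      (λ ((ww , _) , _) → ~⇒≢ ww refl)

    four-< : ∀ {u} → Single φ u w → # (λ s → four? s u) < σ φ u
    four-< {u} uw = #-strict (λ s → four? s u) (single? φ u) (proj₁ ∘ proj₂) w uw
      (λ ((ww , _) , _) → ~⇒≢ ww refl)

    no-four : ∀ {u} → σ φ u ≤ 2 → # (λ s → four? s u) ≡ 0
    no-four {u} σ≤2 = #-∅ (λ s → four? s u) (λ _ (_ , _ , _ , _ , σ≰2 , _) → σ≰2 σ≤2)

    load′-bound : ∀ {u a b} → # (λ s → two? s u) ≤ a → # (λ s → four? s u) ≤ b → load′ u ≤ 3 * a + 2 * b
    load′-bound a≤ b≤ = +-mono-≤ (*-monoʳ-≤ 3 a≤) (*-monoʳ-≤ 2 b≤)

    load′-narrow : ∀ {u} → Narrow u → load′ u ≤ 3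
    load′-narrow {u} (uw , σ≤2) =
      load′-bound {u} {1} {0} (≤-pred (≤-trans (two-< uw) σ≤2)) (≤-reflexive (no-four σ≤2))

    -- Any charge to u makes u a candidate itself, so other vertices carry 0. With `σ φ u ≤ 2` there
    -- are at most two charges of weight 3, and only one if u is narrow. With three or four singles
    -- there are at most three charges of weight 2, as w itself is not charged.
    load′-≤ : ∀ {u} (c? : Dec (Candidate u)) (n? : Dec (Narrow u)) → load′ u ≤ weight c? n?
    load′-≤ {u} (no ¬c) _ = load′-bound {u} {0} {0}
      (≤-reflexive (#-∅ (λ s → two? s u) λ s (_ , us , wu , σ≤2) → ¬c (wu , (s , us) , inj₁ σ≤2)))
      (≤-reflexive (#-∅ (λ s → four? s u) λ s (_ , us , wu , uw , _ , σ≤4) → ¬c (wu , (s , us) , inj₂ (uw , σ≤4))))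
    load′-≤ (yes _) (yes narrow) = m≤n⇒m≤1+n (load′-narrow narrow)
    load′-≤ {u} (yes (_ , _ , few)) (no _) = wide (σ φ u ≤? 2) few
      where
      wide : Dec (σ φ u ≤ 2) → σ φ u ≤ 2 ⊎ (Single φ u w × σ φ u ≤ 4) → load′ u ≤ 6
      wide (yes σ≤2) _          = load′-bound {u} {2} {0} (≤-trans (two-≤ u) σ≤2) (≤-reflexive (no-four σ≤2))
      wide (no σ≰2) (inj₁ σ≤2)  = contradiction σ≤2 σ≰2
      wide (no σ≰2) (inj₂ (uw , σ≤4)) = load′-bound {u} {0} {3}
        (≤-reflexive (#-∅ (λ s → two? s u) λ s (_ , _ , _ , σ≤2) → σ≰2 σ≤2))
        (≤-pred (≤-trans (four-< uw) σ≤4))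

    weight-narrow : ∀ {u} (c? : Dec (Candidate u)) (n? : Dec (Narrow u)) → w ~ u → Narrow u →
                    weight c? n? ≡ 4
    weight-narrow (yes _) (yes _) _ _ = refl
    weight-narrow (yes _) (no ¬n) _ n = contradiction n ¬n
    weight-narrow (no ¬c) _ wu (uw , σ≤2) = contradiction (wu , (w , uw) , inj₁ σ≤2) ¬c

    capacity-narrow : ∀ {u} → w ~ u → Narrow u → load′ u < capacity u
    capacity-narrow {u} wu narrow =
      ≤-trans (s≤s (load′-narrow narrow)) (≤-reflexive (sym (weight-narrow (candidate? u) (narrow? u) wu narrow)))

    LightLoad : Fin n → Set
    LightLoad s = Candidate s × # (two? s) ≤ 1 × # (four? s) ≤ 2 × (Narrow s → # (four? s) ≤ 1)

    light : ∀ {s a b} (c? : Dec (Candidate s)) (n? : Dec (Narrow s)) → 3 * a + 2 * b < weight c? n? →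
            Candidate s × a ≤ 1 × b ≤ 2 × (Narrow s → b ≤ 1)
    -- A vertex that is no candidate has capacity 0, and no load lies below that.
    light {s} {a} {b} (yes c) n? lt = c ,
      ≤-pred (*-cancelˡ-< 3 a 2 (≤-<-trans (m≤m+n (3 * a) (2 * b)) (<-≤-trans lt (weight≤6 n?)))) ,
      ≤-pred (*-cancelˡ-< 2 b 3 (≤-<-trans (m≤n+m (2 * b) (3 * a)) (<-≤-trans lt (weight≤6 n?)))) ,
      b≤1 n? lt
      where
      weight≤6 : ∀ n? → weight (yes c) n? ≤ 6
      weight≤6 (yes _) = m≤m+n 4 2
      weight≤6 (no _)  = ≤-refl
      b≤1 : ∀ n? → 3 * a + 2 * b < weight (yes c) n? → Narrow s → b ≤ 1
      b≤1 (yes _) lt _ = ≤-pred (*-cancelˡ-< 2 b 2 (≤-<-trans (m≤n+m (2 * b) (3 * a)) lt))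
      b≤1 (no ¬n) _  n = contradiction n ¬n

    -- One narrow neighbour of w makes the total charge strictly smaller than the total capacity, so
    -- some load is below its capacity.
    light-load : ∀ {u} → w ~ u → Narrow u → ∃ LightLoad
    light-load {u} wu narrow = conclude (sum-<⇒∃< load capacity
      (subst (_< sum capacity) (sym Σ-load)
        (sum-mono-< (λ u → load′-≤ (candidate? u) (narrow? u)) u (capacity-narrow wu narrow))))
      where
      conclude : (∃[ s ] load s < capacity s) → ∃ LightLoad
      conclude (s , lt) = s , light (candidate? s) (narrow? s) lt

  -- Repairing one bad vertex.

  module _ {k} (large : ∀ u → deg u + 6 ≤ k) where

    record Improvement (φ : Fin n → Fin k) (v : Fin n) : Set where
      constructor improvement
      field
        colouring : Fin n → Fin k
        proper    : IsProper G colouring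
        keeps     : ∀ {u} → Satisfied φ u → Satisfied colouring u
        satisfies : Satisfied colouring v

    recolour-near : ∀ {φ v s} → IsProper G φ → v ~ s → ∃ (Safe φ s) → Improvement φ v
    recolour-near {φ} {v} {s} proper vs (c , c≢φs , ¬seen , ¬danger) = improvement R.φ′ R.proper′
      (R.still-satisfied ¬danger) (R.near-satisfied ¬danger vs)
      where module R = Recolour φ proper s c c≢φs ¬seen

    module _ (φ : Fin n → Fin k) (proper : IsProper G φ) (v : Fin n) (unsat : ¬ Satisfied φ v)
             (w : Fin n) (vw : v ~ w) (few : # (harmfulNear? φ v w) ≤ 1) where

      open Averaging φ w

      -- Seen colours and away vertices take d + 3 colours, the present colour takes one and a
      -- single further cause of danger one more: d + 5 in all.
      budget : ∀ {a b t d} → a + b ≤ d + 3 → t ≤ 1 → d + 6 ≤ k → a + (1 + (t + b)) < k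
      budget {a} {b} {t} {d} ab≤ t≤1 d+6≤k = begin-strict
        a + (1 + (t + b)) ≡⟨ solve 3 (λ a b t → a :+ (con 1 :+ (t :+ b)) := (a :+ b) :+ (con 1 :+ t)) refl a b t ⟩
        (a + b) + (1 + t) ≤⟨ +-mono-≤ ab≤ (s≤s t≤1) ⟩
        (d + 3) + 2       ≡⟨ +-assoc d 3 2 ⟩
        d + 5             <⟨ +-monoʳ-< d ≤-refl ⟩
        d + 6             ≤⟨ d+6≤k ⟩
        k                 ∎
        where open ≤-Reasoning

      -- Exactly two singles make w see few colours. Dangers for w come from at most one harmful
      -- vertex of N(v) or from the clique of N(w) away from v; v itself has no single and causes
      -- none.
      safe-if-tight : ∀ {s x} → Tight φ w s x → ∃ (Safe φ w)
      safe-if-tight t = find-safe φ refl (atMost-≡ _)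
        (atMost-∪ (atMost-# (harmfulNear? φ v w)) (atMost-# (away? φ proper w v))) source (_≟ φ w) bound
        where
        source : ∀ u x → Tight φ u w x → ¬ Seen φ w (φ x) → φ x ≢ φ w →
                 HarmfulNear φ v w u ⊎ Away φ proper w v u
        source u x t@((uw , only) , _) ¬seen _ with adj? G v u
        ... | yes vu = inj₁ (vw , vu , x , t , ¬seen)
        ... | no ¬vu = inj₂ (~-sym uw , (λ { refl → unsat (w , uw , only) }) , ¬vu)
        bound : # (seen? φ w) + (1 + (# (harmfulNear? φ v w) + # (away? φ proper w v))) < k
        bound = budget (away-budget φ proper (~-sym vw) (inj₁ (tight-σ φ t))) few (large w)

      -- Every danger for w comes from a narrow vertex, so only the seen colours and the present one
      -- are blocked.
      safe-if-no-narrow : (∀ u → ¬ Narrow u) → ∃ (Safe φ w)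
      safe-if-no-narrow ¬narrow = find-safe φ refl (atMost-≡ _)
        (atMost-∅ {P = λ _ → ⊥} λ _ ()) (λ u x t _ _ → ¬narrow u (proj₁ t , tight-σ φ t)) (_≟ φ w)
        (≤-<-trans (+-monoˡ-≤ 1 (seen-≤-deg φ w)) (<-≤-trans (+-monoʳ-< (deg w) (m≤m+n 2 4)) (large w)))

      -- A danger for s arises inside N(w), which the light load limits to one vertex, or away from
      -- w, or at w itself, which `¬tight` excludes.
      safe-light : (∀ s x → ¬ Tight φ w s x) → ∀ s → LightLoad s → ∃ (Safe φ s)
      safe-light ¬tight s (candidate@(ws , _ , few-singles) , two≤1 , _) =
        find-safe φ refl (atMost-≡ _)
          (atMost-∪ (atMost-# (two? s)) (atMost-# (away? φ proper s w))) source (_≟ φ s) bound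
        where
        source : ∀ u x → Tight φ u s x → ¬ Seen φ s (φ x) → φ x ≢ φ s → Two s u ⊎ Away φ proper s w u
        source u x t@(us , _) _ _ with adj? G w u
        ... | yes wu = inj₁ (candidate , us , wu , tight-σ φ t)
        ... | no ¬wu = inj₂ (~-sym (proj₁ us) , (λ { refl → ¬tight s x t }) , ¬wu)
        bound : # (seen? φ s) + (1 + (# (two? s) + # (away? φ proper s w))) < k
        bound = budget (away-budget φ proper (~-sym ws) few-singles) two≤1 (large s)

      module _ (s : Fin n) (c : Fin k) (¬vs : ¬ v ~ s) (light : LightLoad s) (safe : Safe φ s c) where

        open Recolour φ proper s c (proj₁ safe) (proj₁ (proj₂ safe))

        -- After recolouring s, a danger for w comes from s itself, from a neighbour of s and then
        -- through `Four`, or from a vertex that was harmful near v before. These are at most 1 + 2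
        -- causes, and with the two exceptional colours at most deg + 5 colours are blocked.
        safe-after : ∃ (Safe φ′ w)
        -- The old colour of s is excluded as well: w may no longer see it, so a danger of this
        -- colour could have escaped the count in `few`.
        safe-after = find-safe φ′ {E = (_≡ φ′ w) ∪ (_≡ φ s)} (inj₁ refl)
          (atMost-∪ (atMost-≡ _) (atMost-≡ _))
          (atMost-∪ (atMost-# (harmfulNear? φ v w)) (atMost-local (narrow? s)))
          source (λ d → d ≟ φ′ w ⊎-dec d ≟ φ s) bound
          where
          ws : w ~ s
          ws = proj₁ (proj₁ light)

          Local : Fin n → Set
          Local u = (u ≡ s × Narrow s) ⊎ Four s u

          -- If s is narrow it uses one of the two places, but then its smaller capacity leaves at
          -- most one vertex in `Four`.
          atMost-local : Dec (Narrow s) → AtMost 2 Local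
          atMost-local (yes narrow) = atMost-∪ (atMost-1 λ (e , _) (e′ , _) → trans e (sym e′))
            (atMost-≤ (proj₂ (proj₂ (proj₂ light)) narrow) (atMost-# (four? s)))
          atMost-local (no ¬narrow) = atMost-⊆
            (λ { (inj₁ (_ , narrow)) → contradiction narrow ¬narrow ; (inj₂ four) → four })
            (atMost-≤ (proj₁ (proj₂ (proj₂ light))) (atMost-# (four? s)))

          v≢s : v ≢ s
          v≢s refl = unsat (proj₁ (proj₂ (proj₁ light)))

          source : ∀ u x → Tight φ′ u w x → ¬ Seen φ′ w (φ′ x) → ¬ ((_≡ φ′ w) ∪ (_≡ φ s)) (φ′ x) →
                   HarmfulNear φ v w u ⊎ Local u
          source u x t ¬seen′ ¬E with u ≟ s | adj? G u s
          ... | yes refl | _ = inj₂ (inj₁ (refl , proj₁ t₀ , tight-σ φ t₀))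
            where t₀ = tight-cong (λ y sy → sym (φ′-far (λ ss → ~⇒≢ ss refl) y sy)) t
          ... | no u≢s | yes us = let uw , us₁ , σ≰2 , σ≤4 = new-danger us ws t ¬seen′ (¬E ∘ inj₂) in
            inj₂ (inj₂ (proj₁ light , us₁ , ~-sym (proj₁ uw) , uw , σ≰2 , σ≤4))
          ... | no u≢s | no ¬us = inj₁ (vw , vu , x , t₀ , ¬seen)
            where
            t₀ : Tight φ u w x
            t₀ = tight-cong (λ y uy → sym (φ′-far ¬us y uy)) t
            φ≡φ′x : φ x ≡ φ′ x
            φ≡φ′x = φ′-far ¬us x (proj₁ (proj₁ (proj₂ t)))
            ¬seen : ¬ Seen φ w (φ x)
            ¬seen (y , wy , e) with y ≟ s
            ... | yes refl = ¬E (inj₂ (sym (trans e φ≡φ′x)))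
            ... | no  y≢s  = ¬seen′ (y , wy , trans (φ′-off y≢s) (trans e φ≡φ′x))
            vu : v ~ u
            -- Neither v nor u is adjacent to s, so the three neighbours v, u, s of w escape being a
            -- claw only by v ~ u.
            vu with claw-free (~-sym vw) (~-sym (proj₁ (proj₁ t))) ws
                      (λ { refl → unsat (w , proj₁ t₀) }) v≢s u≢s
            ... | inj₁ vu        = vu
            ... | inj₂ (inj₁ vs) = contradiction vs ¬vs
            ... | inj₂ (inj₂ us) = contradiction us ¬us

          bound : # (seen? φ′ w) + (2 + (# (harmfulNear? φ v w) + 2)) < k
          bound = budget′ (seen-≤-deg φ′ w) few (large w)
            where
            budget′ : ∀ {a t d} → a ≤ d → t ≤ 1 → d + 6 ≤ k → a + (2 + (t + 2)) < k
            budget′ {d = d} a≤d t≤1 d+6≤k = <-≤-trans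
              (≤-<-trans (+-mono-≤ a≤d (+-monoʳ-≤ 2 (+-monoˡ-≤ 2 t≤1))) (+-monoʳ-< d ≤-refl)) d+6≤k

        improve-after : Improvement φ v
        improve-after = improvement I.colouring I.proper
          (I.keeps ∘ still-satisfied (proj₂ (proj₂ safe))) I.satisfies
          where module I = Improvement (recolour-near proper′ vw safe-after)

      improve-via : Improvement φ v
      improve-via = case any? (safe? φ w) of λ where
        (yes safe)  → recolour-near proper vw safe
        (no ∄safe) → case any? narrow? of λ where
          (no ∄narrow) → contradiction (safe-if-no-narrow λ u narrow → ∄narrow (u , narrow)) ∄safe
          (yes (u , narrow)) →
            let s , light = light-load (~-sym (proj₁ (proj₁ narrow))) narrow
                c , safe  = safe-light (λ _ _ t → ∄safe (safe-if-tight t)) s light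
            in case adj? G v s of λ where
              (yes vs) → recolour-near proper vs (c , safe)
              (no ¬vs) → improve-after s c ¬vs light safe

    improve : ∀ φ → IsProper G φ → ∀ v → ∃ (v ~_) → Improvement φ v
    improve φ proper v nonisolated = case satisfied? φ v of λ where
      (yes sat)  → improvement φ proper id sat
      (no unsat) → let w , vw , few = few-harmful φ proper v unsat nonisolated in
        improve-via φ proper v unsat w vw few

    -- Treating all vertices in turn.

    -- One pass suffices because a step never spoils what is already good. It serves both to build a
    -- proper colouring and to repair the bad vertices.
    fix-all : {C : Set} (OK : C → Fin n → Set) →
              (∀ c x → ∃[ c′ ] OK c′ x × (∀ {u} → OK c u → OK c′ u)) →
              C → ∃[ c ] ∀ x → OK c x
    fix-all {C} OK step c₀ = let c , oks = go (List.allFin n) in c , λ x → ListAll.lookup oks (∈-allFin x)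
      where
      go : ∀ xs → ∃[ c ] ListAll.All (OK c) xs
      go []       = c₀ , ListAll.[]
      go (x ∷ xs) = let c , oks = go xs ; c′ , ok , keeps = step c x in c′ , ok ListAll.∷ ListAll.map keeps oks

    free-colour : ∀ φ s → ∃[ c ] ¬ Seen φ s c
    free-colour φ s with any? (λ c → ¬? (seen? φ s c))
    ... | yes free = free
    ... | no ∄free = contradiction
      (≤-trans (pigeonhole (atMost-# (seen? φ s)) (λ c → decidable-stable (seen? φ s c) λ ¬seen → ∄free (c , ¬seen)))
               (seen-≤-deg φ s))
      (<⇒≱ (<-≤-trans (m<m+n (deg s) (s≤s z≤n)) (large s)))

    proper-colouring : (Fin n → Fin k) → ∃ (IsProper G {k})
    proper-colouring = fix-all Unclashing λ φ s → let c , ¬seen = free-colour φ s in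
      recolour φ s c , recolour-fixes ¬seen , recolour-keeps ¬seen

    pcf-colourable : (Fin n → Fin k) → PCFColorable G k
    pcf-colourable φ₀ = let (φ , proper) , good = fix-all Good step (proper-colouring φ₀) in
      φ , proper , λ v nonisolated → let x , vx , only = good v nonisolated in
        φ x , x , (vx , refl) , λ (vy , e) → sym (only _ vy e)
      where
      Good : ∃ (IsProper G {k}) → Fin n → Set
      Good (φ , _) v = ∃ (v ~_) → Satisfied φ v
      step : ∀ φ v → ∃[ φ′ ] Good φ′ v × (∀ {u} → Good φ u → Good φ′ u)
      step (φ , proper) v with any? (adj? G v)
      ... | no isolated = (φ , proper) , (λ nb → contradiction nb isolated) , id
      ... | yes nb = let module I = Improvement (improve φ proper v nb) in
        (I.colouring , I.proper) , (λ _ → I.satisfies) , λ good nb → I.keeps (good nb)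

theorem1p9 : ∀ (n : ℕ) (G : Graph n) → ClawFree G → χpcf G ≤ Δ G + 6
-- The start is a constant colouring; its colour exists because the 6 extra colours make the palette
-- nonempty even when `Δ G` is 0.
theorem1p9 n G cf = proj₂ (χpcf-isLeast G) (Δ G + 6) (pcf-colourable G cf large λ _ → Δ G ↑ʳ zero)
  where
  large : ∀ u → deg G cf u + 6 ≤ Δ G + 6
  large u = +-monoˡ-≤ 6 (begin
    # (adj? G u) ≡⟨ ∣tabulate∣≡# (adj? G u) ⟨
    degree G u   ≤⟨ ListAll.lookup (xs≤max 0 (List.tabulate (degree G))) (∈-tabulate⁺ u) ⟩
    Δ G          ∎)
    where open ≤-Reasoning
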